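{- Let $\mathcal B$ be a Golomb system and $\kappa$ a Kirch function for $\mathcal B$. The spaces $(\mathbb Z,\mathcal T_{\mathcal B,\kappa})$ and $(\mathbb N_1,\mathcal T_{\mathcal B,\kappa})$ are locally connected if and only if $\kappa(p)<\infty$ holds for every prime $p$. Moreover, if this happens then they are locally superconnected.
   Context: Notation: $\mathbb N=\{0,1,2,\dots\}$, $\mathbb N_1=\mathbb N-\{0\}$, $\mathcal P$ is the set of prime numbers, $v_p$ the $p$-adic valuation; $[a]_n$ is the class of $a$ in $\mathbb Z/n\mathbb Z$; for $n\mid m$, $\pi_n^m\colon\mathbb Z/m\mathbb Z\to\mathbb Z/n\mathbb Z$ is the natural projection. Golomb system: fix $\gamma\colon\mathcal P\to\mathbb N$ and, for each prime $p$, a nonempty subset $B_{p^{\gamma(p)}}\subseteq\mathbb Z/p^{\gamma(p)}\mathbb Z$, with $B_{p^{\gamma(p)}}\neq\mathbb Z/p^{\gamma(p)}\mathbb Z$ if $\gamma(p)>0$. Define $B_n\subseteq\mathbb Z/n\mathbb Z$ for all $n\in\mathbb N_1$ by: $B_1=\mathbb Z/1\mathbb Z$; $B_{p^r}=(\pi_{p^{\gamma(p)}}^{p^r})^{ -1}(B_{p^{\gamma(p)}})$ if $r\ge\gamma(p)$; $B_{p^r}=\pi_{p^r}^{p^{\gamma(p)}}(B_{p^{\gamma(p)}})$ if $r<\gamma(p)$; and $B_n=\bigcap_{p\mid n}(\pi^n_{p^{v_p(n)}})^{ -1}(B_{p^{v_p(n)}})$ in general. The family $\mathcal B=\{B_n\}_{n\in\mathbb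 N_1}$ is called a Golomb system. It is always assumed that $\gamma(p)$ is the smallest value giving rise to $\mathcal B$, i.e. the smallest $r$ such that $B_{p^s}=(\pi_{p^r}^{p^s})^{ -1}(B_{p^r})$ for all $s\ge r$. A Kirch function for $\mathcal B$ is a map $\kappa\colon\mathcal P\to\mathbb N\cup\{\infty\}$ with $\gamma(p)\le\kappa(p)$ for every $p$; it is always assumed that $\kappa(p)=0$ if $\gamma(p)=0$. The topology $\mathcal T_{\mathcal B,\kappa}$ on $\mathbb Z$ has as subbase the cosets $a+p^r\mathbb Z$ with $a\in\mathbb Z$, $p\in\mathcal P$, $r\in\mathbb N$, $\gamma(p)\le r\le\kappa(p)$ and $[a]_{p^r}\notin B_{p^r}$. On $\mathbb N_1$ the subspace topology is taken. A topological space $X$ is superconnected if for any $r\in\mathbb N_1$ and any nonempty open subsets $U_1,\dots,U_r$ of $X$ one has $\bigcap_i\overline{U_i}\ne\emptyset$ (closures in $X$). Locally connected (respectively, locally superconnected) means that every point has a base of neighbourhoods consisting of connected (respectively, superconnected) open sets. -}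

module Defs where

open import Data.Fin using (Fin; toℕ; fromℕ<)
open import Data.Fin.Subset using (Subset; Nonempty; ⊤) renaming (_∈_ to _∈ₛ_)
open import Data.Integer using (ℤ; +_; 0ℤ; _%ℕ_)
  renaming (_+_ to _+ℤ_; _*_ to _*ℤ_; _<_ to _<ℤ_)
open import Data.Integer.DivMod using (n%ℕd<d)
open import Data.List using (List; []; _++_)
open import Data.List.Relation.Unary.All using (All; [])
open import Data.List.Relation.Unary.All.Properties using (++⁺; ++⁻)
open import Data.Nat using (ℕ; _≤_; _<_; _>_; _^_; _≤?_; NonZero)
open import Data.Nat using () renaming (suc to 1+)
open import Data.Nat.Divisibility using (_∣_)
open import Data.Nat.Primality using (Prime; prime⇒nonZero)
open import Data.Nat.Properties using (m^n≢0)
open import Data.Product using (Σ; Σ-syntax; ∃; ∃-syntax; _×_; _,_; proj₁; proj₂)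
open import Data.Unit using (tt) renaming (⊤ to Unit)
open import Function using (_∘_)
open import Level using (0ℓ; suc)
open import Relation.Binary.PropositionalEquality using (_≡_; _≢_)
open import Relation.Nullary using (¬_; yes; no)
open import Relation.Nullary.Construct.Add.Supremum using (_⁺; ⊤⁺; [_])
open import Relation.Binary.Construct.Add.Supremum.NonStrict _≤_ using (_≤⁺_)
open import Relation.Binary.Construct.Add.Supremum.Strict _<_ using (_<⁺_)
open import Relation.Unary
  using (Pred; _∈_; _∉_; _⊆_; _≐_; _∩_; _∪_; _≬_; _⊢_; U; ⋃; Universal; Empty; Satisfiable)

------------------------------------------------------------------------
-- Topological spaces

-- Subsets of X are predicates in Pred X 0ℓ, so unions are indexed by
-- types in Set; the empty set is the union indexed by ⊥.
record Topology (X : Set) : Set₂ where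
  field
    IsOpen     : Pred (Pred X 0ℓ) (suc 0ℓ)
    IsOpen-≐   : ∀ {V W} → V ≐ W → IsOpen V → IsOpen W
    IsOpen-U   : IsOpen U
    IsOpen-∩   : ∀ {V W} → IsOpen V → IsOpen W → IsOpen (V ∩ W)
    IsOpen-⋃   : ∀ {I : Set} {V : I → Pred X 0ℓ} →
                 (∀ i → IsOpen (V i)) → IsOpen (⋃[ i ∶ I ] V i)

open Topology public

⋂[_] : {X I : Set} → (I → Pred X 0ℓ) → List I → Pred X 0ℓ
⋂[ S ] is x = All (λ i → x ∈ S i) is

generatedBy : {X I : Set} → (I → Pred X 0ℓ) → Topology X
generatedBy {X} {I} S = record
  { IsOpen   = λ V → Σ[ J ∈ Set ] Σ[ f ∈ (J → List I) ] V ≐ (⋃[ j ∶ J ] ⋂[ S ] (f j))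
  ; IsOpen-≐ = λ { (V⊆W , W⊆V) (J , f , V⊆ , ⊆V) → J , f , V⊆ ∘ W⊆V , V⊆W ∘ ⊆V }
  ; IsOpen-U = Unit , (λ _ → []) , (λ _ → tt , []) , _
  ; IsOpen-∩ = λ { (J , f , V⊆ , ⊆V) (K , g , W⊆ , ⊆W) →
      (J × K) , (λ { (j , k) → f j ++ g k }) ,
      (λ { (x∈V , x∈W) →
         let (j , a) = V⊆ x∈V ; (k , b) = W⊆ x∈W in (j , k) , ++⁺ a b }) ,
      (λ { ((j , k) , a) →
         let (b , c) = ++⁻ (f j) a in ⊆V (j , b) , ⊆W (k , c) }) }
  ; IsOpen-⋃ = λ {A} o →
      (Σ[ a ∈ A ] proj₁ (o a)) ,
      (λ { (a , j) → proj₁ (proj₂ (o a)) j }) ,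
      (λ { (a , x∈V) →
         let (j , b) = proj₁ (proj₂ (proj₂ (o a))) x∈V in (a , j) , b }) ,
      (λ { ((a , j) , b) → a , proj₂ (proj₂ (proj₂ (o a))) (j , b) })
  }

subspace : {X : Set} → Topology X → (A : Pred X 0ℓ) → Topology (∃ A)
subspace T A = record
  { IsOpen   = λ V → ∃[ W ] IsOpen T W × V ≐ (proj₁ ⊢ W)
  ; IsOpen-≐ = λ { (V⊆V′ , V′⊆V) (W , o , V⊆ , ⊆V) →
      W , o , V⊆ ∘ V′⊆V , V⊆V′ ∘ ⊆V }
  ; IsOpen-U = U , IsOpen-U T , _ , _
  ; IsOpen-∩ = λ { (W , o , V⊆ , ⊆V) (W′ , o′ , V′⊆ , ⊆V′) →
      W ∩ W′ , IsOpen-∩ T o o′ ,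
      (λ { (a , b) → V⊆ a , V′⊆ b }) , (λ { (a , b) → ⊆V a , ⊆V′ b }) }
  ; IsOpen-⋃ = λ {I} o →
      (⋃[ i ∶ I ] proj₁ (o i)) , IsOpen-⋃ T (λ i → proj₁ (proj₂ (o i))) ,
      (λ { (i , a) → i , proj₁ (proj₂ (proj₂ (o i))) a }) ,
      (λ { (i , a) → i , proj₂ (proj₂ (proj₂ (o i))) a })
  }

-- x is in the closure of A when every open set around x meets A.
closure : {X : Set} → Topology X → Pred X 0ℓ → Pred X (suc 0ℓ)
closure T A x = ∀ V → IsOpen T V → x ∈ V → V ≬ A

Connected : {X : Set} → Topology X → Set₁
Connected {X} T = ¬ (∃[ V ] ∃[ W ] IsOpen T V × IsOpen T W ×
  Satisfiable V × Satisfiable W × Empty (V ∩ W) × Universal (V ∪ W))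

Superconnected : {X : Set} → Topology X → Set₁
Superconnected {X} T = (r : ℕ) .{{_ : NonZero r}} (V : Fin r → Pred X 0ℓ) →
  (∀ i → IsOpen T (V i)) → (∀ i → Satisfiable (V i)) →
  ∃[ x ] (∀ i → x ∈ closure T (V i))

Neighbourhood : {X : Set} → Topology X → X → Pred (Pred X 0ℓ) (suc 0ℓ)
Neighbourhood T x N = ∃[ V ] IsOpen T V × x ∈ V × V ⊆ N

IsNeighbourhoodBase : {X : Set} → Topology X → X → Pred (Pred X 0ℓ) (suc 0ℓ) → Set₁
IsNeighbourhoodBase T x 𝓕 =
  (∀ N → N ∈ 𝓕 → Neighbourhood T x N) ×
  (∀ N → Neighbourhood T x N → ∃[ V ] V ∈ 𝓕 × V ⊆ N)

Locally : (∀ {X : Set} → Topology X → Set₁) → {X : Set} → Topology X → Set₂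
Locally P T = ∀ x → ∃[ 𝓕 ] IsNeighbourhoodBase T x 𝓕 ×
  (∀ V → V ∈ 𝓕 → IsOpen T V × P (subspace T V))

LocallyConnected LocallySuperconnected : {X : Set} → Topology X → Set₂
LocallyConnected      = Locally Connected
LocallySuperconnected = Locally Superconnected

------------------------------------------------------------------------
-- Residue classes; ℤ/nℤ is represented by Fin n

𝒫 : Set
𝒫 = ∃ Prime

cls : (n : ℕ) .{{_ : NonZero n}} → ℤ → Fin n
cls n a = fromℕ< (n%ℕd<d a n)

-- The natural projection ℤ/mℤ → ℤ/nℤ; only meaningful (and only used)
-- when n ∣ m.
π : (m n : ℕ) .{{_ : NonZero n}} → Fin m → Fin n
π m n c = cls n (+ toℕ c)

prime^≢0 : (p : 𝒫) (r : ℕ) → NonZero (proj₁ p ^ r)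
prime^≢0 (p , p-prime) r = m^n≢0 p r {{prime⇒nonZero p-prime}}

clsₚ : (p : 𝒫) (r : ℕ) → ℤ → Fin (proj₁ p ^ r)
clsₚ p r = cls (proj₁ p ^ r) {{prime^≢0 p r}}

πₚ : (m : ℕ) (p : 𝒫) (r : ℕ) → Fin m → Fin (proj₁ p ^ r)
πₚ m p r = π m (proj₁ p ^ r) {{prime^≢0 p r}}

coset : ℤ → ℕ → Pred ℤ 0ℓ
coset a n x = ∃[ k ] x ≡ a +ℤ (+ n) *ℤ k

-- v_p(n) = s
_^_∥_ : ℕ → ℕ → ℕ → Set
p ^ s ∥ n = p ^ s ∣ n × ¬ (p ^ 1+ s ∣ n)

------------------------------------------------------------------------
-- Golomb systems

record GolombData : Set where
  field
    γ        : 𝒫 → ℕ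
    B₀       : (p : 𝒫) → Subset (proj₁ p ^ γ p)
    nonempty : ∀ p → Nonempty (B₀ p)
    proper   : ∀ p → γ p > 0 → B₀ p ≢ ⊤

  B-primePower : (p : 𝒫) (r : ℕ) → Pred (Fin (proj₁ p ^ r)) 0ℓ
  B-primePower p r c with γ p ≤? r
  ... | yes _ = πₚ (proj₁ p ^ r) p (γ p) c ∈ₛ B₀ p
  ... | no  _ = ∃[ b ] b ∈ₛ B₀ p × πₚ (proj₁ p ^ γ p) p r b ≡ c

  -- For n = 1 the condition is vacuous, and for n = p ^ r it agrees with
  -- B-primePower p r.
  B : (n : ℕ) → Pred (Fin n) 0ℓ
  B n c = ∀ (p : 𝒫) (s : ℕ) → proj₁ p ∣ n → proj₁ p ^ s ∥ n →
          πₚ n p s c ∈ B-primePower p s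

record GolombSystem : Set where
  field
    golombData : GolombData

  open GolombData golombData public

  field
    γ-minimal : ∀ p r →
      (∀ s → r ≤ s →
         B (proj₁ p ^ s) ≐ (πₚ (proj₁ p ^ s) p r ⊢ B (proj₁ p ^ r))) →
      γ p ≤ r

ℕ∞ : Set
ℕ∞ = ℕ ⁺

∞ : ℕ∞
∞ = ⊤⁺

record KirchFunction (𝓑 : GolombSystem) : Set where
  open GolombSystem 𝓑
  field
    κ    : 𝒫 → ℕ∞
    γ≤κ  : ∀ p → [ γ p ] ≤⁺ κ p
    κ≡0  : ∀ p → γ p ≡ 0 → κ p ≡ [ 0 ]

module _ (𝓑 : GolombSystem) (K : KirchFunction 𝓑) where
  open GolombSystem 𝓑
  open KirchFunction K

  record SubbaseIndex : Set where
    field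
      a   : ℤ
      p   : 𝒫
      r   : ℕ
      γ≤r : γ p ≤ r
      r≤κ : [ r ] ≤⁺ κ p
      a∉B : clsₚ p r a ∉ B (proj₁ p ^ r)

  subbase : SubbaseIndex → Pred ℤ 0ℓ
  subbase i = coset a (proj₁ p ^ r)
    where open SubbaseIndex i

  𝒯 : Topology ℤ
  𝒯 = generatedBy subbase

  -- ℕ₁ is the set of positive integers inside ℤ.
  𝒯-ℕ₁ : Topology (∃[ z ] 0ℤ <ℤ z)
  𝒯-ℕ₁ = subspace 𝒯 (λ z → 0ℤ <ℤ z)

  κ<∞ : Set
  κ<∞ = ∀ p → κ p <⁺ ∞

{-# OPTIONS --safe #-}
module Submission where

-- If the class of z modulo p ^ γ(p) lies in the Golomb set, then z escapes the
-- prime p: no subbasic coset modulo a power of p contains z.  Otherwise all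
-- z + p ^ r ℤ with γ(p) ≤ r ≤ κ(p) are open.
--
-- If κ is finite, the strongest constraints z ≡ x modulo p ^ κ(p), for p in a
-- finite set P of primes which x does not escape, cut out a base of open boxes.  Such a box is
-- superconnected: given open boxes inside it with primes R₁, …, Rₙ, the
-- Chinese remainder theorem yields a point of the box that escapes every prime
-- of the Rᵢ outside P, and a second application shows
-- that each neighbourhood of that point meets each of the smaller boxes.
--
-- If κ(p) = ∞ and x does not escape p, then an open set V with
-- x ∈ V ⊆ x + p ^ γ(p) ℤ is split by x + p ^ r ℤ as soon as r is so large
-- that V contains a point y ≢ x modulo p ^ r.
--
-- All points needed can be taken positive, so ℤ and ℕ₁ are treated together,
-- as spaces with the topology induced by a map to ℤ with positive integers in
-- its image.

open import Defs
open import Data.Fin using (Fin; toℕ) renaming (zero to fzero; suc to fsuc)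
open import Data.Fin.Properties using (fromℕ<-cong; fromℕ<-toℕ; toℕ-fromℕ<; toℕ<n; ¬∀⟶∃¬)
open import Data.Fin.Subset using () renaming (_∈_ to _∈ₛ_; _∉_ to _∉ₛ_)
open import Data.Fin.Subset.Properties using (⊆-antisym; ⊆⊤) renaming (_∈?_ to _∈ₛ?_)
open import Data.Integer using (ℤ; +_; -[1+_]; 0ℤ; 1ℤ; _+_; _*_; _-_; -_; _^_;
  ∣_∣; _%ℕ_; _/ℕ_; _<_; _≤_; +<+; +≤+)
open import Data.Integer.DivMod using (n%ℕd<d; a≡a%ℕn+[a/ℕn]*n)
import Data.Integer.Properties as ℤ
open import Data.Integer.Divisibility.Signed
  using (_∣_; divides; _∣?_; ∣-trans; ∣m∣n⇒∣m+n; ∣m⇒∣-m; ∣n⇒∣m*n; ∣m⇒∣m*n; ∣⇒∣ᵤ; ∣ᵤ⇒∣)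
open import Data.Integer.Tactic.RingSolver using (solve-∀)
open import Data.List using (List; []; _∷_; _++_; map; concatMap; allFin)
open import Data.List.Membership.Propositional using () renaming (_∈_ to _∈ₗ_)
open import Data.List.Membership.Propositional.Properties
  using (∈-map⁺; ∈-++⁺ˡ; ∈-++⁺ʳ; ∈-concatMap⁺; ∈-allFin)
open import Data.List.Relation.Unary.All as All using (All; []; _∷_)
open import Data.List.Relation.Unary.Any using (here; there)
import Data.List.Relation.Unary.Any as Any
open import Data.Nat as ℕ using (ℕ; NonZero; z<s)
open import Data.Nat.Coprimality using (Coprime; coprime-Bézout)
import Data.Nat.Divisibility as ℕ
open import Data.Nat.DivMod using (m<n⇒m%n≡m)
open import Data.Nat.GCD using (module Bézout)
open import Data.Nat.ListAction using (product)
open import Data.Nat.ListAction.Properties using (∈⇒∣product)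
open import Data.Nat.Primality
  using (Prime; prime; euclidsLemma; prime⇒irreducible; prime⇒nonTrivial; prime⇒nonZero)
import Data.Nat.Properties as ℕ
open import Data.Product using (∃; ∃-syntax; _×_; _,_; proj₁; proj₂)
open import Data.Unit using (tt) renaming (⊤ to Unit)
open import Data.Sum using (_⊎_; inj₁; inj₂; [_,_]′)
open import Function using (_∘_; id)
open import Function.Bundles using (_⇔_; mk⇔; module Equivalence)
open import Level using (0ℓ)
open import Relation.Binary.Construct.Add.Supremum.NonStrict ℕ._≤_ using (_≤⁺_; [_]; _≤⊤⁺)
open import Relation.Binary.Construct.Add.Supremum.Strict ℕ._<_ using (_<⁺_; [_]<⊤⁺)
open import Relation.Binary.Definitions using (tri<; tri≈; tri>)
open import Relation.Binary.PropositionalEquality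
  using (_≡_; _≢_; refl; sym; trans; cong; cong₂; subst)
open import Relation.Nullary using (¬_; Dec; yes; no; contradiction)
open import Relation.Nullary.Decidable using (decidable-stable; map′)
open import Relation.Nullary.Construct.Add.Supremum using ([_]; ⊤⁺)
open import Relation.Unary
  using (Pred; _∈_; _⊆_; _≐_; _⊢_; _≬_; ⋃)
open import Relation.Unary.Properties using (≐-refl; ≐-sym)

-- Congruences of integers and residue classes.

infix 4 _≈_⟨mod_⟩

-- A record, so that `a`, `b` and `n` can be inferred from the type of a congruence.
record _≈_⟨mod_⟩ (a b : ℤ) (n : ℕ) : Set where
  constructor mod
  field ∣-difference : + n ∣ a - b

≈-refl : ∀ {a n} → a ≈ a ⟨mod n ⟩
≈-refl {a} = mod (divides 0ℤ (ℤ.+-inverseʳ a))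

≈-sym : ∀ {a b n} → a ≈ b ⟨mod n ⟩ → b ≈ a ⟨mod n ⟩
≈-sym {a} {b} {n} (mod p) = mod (subst (+ n ∣_) (lemma a b) (∣m⇒∣-m p))
  where
  lemma : ∀ a b → - (a - b) ≡ b - a
  lemma = solve-∀

≈-trans : ∀ {a b c n} → a ≈ b ⟨mod n ⟩ → b ≈ c ⟨mod n ⟩ → a ≈ c ⟨mod n ⟩
≈-trans {a} {b} {c} {n} (mod p) (mod q) = mod (subst (+ n ∣_) (lemma a b c) (∣m∣n⇒∣m+n p q))
  where
  lemma : ∀ a b c → (a - b) + (b - c) ≡ a - c
  lemma = solve-∀

≈-*-cong : ∀ {a b c d n} → a ≈ b ⟨mod n ⟩ → c ≈ d ⟨mod n ⟩ → a * c ≈ b * d ⟨mod n ⟩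
≈-*-cong {a} {b} {c} {d} {n} (mod p) (mod q) =
  mod (subst (+ n ∣_) (lemma a b c d) (∣m∣n⇒∣m+n (∣m⇒∣m*n c p) (∣n⇒∣m*n b q)))
  where
  lemma : ∀ a b c d → (a - b) * c + b * (c - d) ≡ a * c - b * d
  lemma = solve-∀

≈-weaken : ∀ {a b m n} → m ℕ.∣ n → a ≈ b ⟨mod n ⟩ → a ≈ b ⟨mod m ⟩
≈-weaken m∣n (mod p) = mod (∣-trans (∣ᵤ⇒∣ m∣n) p)

a+nk≈a : ∀ a n k → a + + n * k ≈ a ⟨mod n ⟩
a+nk≈a a n k = mod (divides k (lemma a (+ n) k))
  where
  lemma : ∀ a n k → a + n * k - a ≡ k * n
  lemma = solve-∀

+-≈ : ∀ a {m n} → m ℕ.∣ n → a + + n ≈ a ⟨mod m ⟩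
+-≈ a {m} {n} m∣n = mod (subst (+ m ∣_) (lemma a (+ n)) (∣ᵤ⇒∣ m∣n))
  where
  lemma : ∀ a n → n ≡ a + n - a
  lemma = solve-∀

_≈?_⟨mod_⟩ : ∀ a b n → Dec (a ≈ b ⟨mod n ⟩)
a ≈? b ⟨mod n ⟩ = map′ mod (λ { (mod n∣) → n∣ }) (+ n ∣? a - b)

0<a+n : ∀ {a} n → 0ℤ < a → 0ℤ < a + + n
0<a+n {a} n 0<a = ℤ.<-≤-trans 0<a (ℤ.i≤i+j a (+ n))

coset⇒≈ : ∀ a n {z} → z ∈ coset a n → z ≈ a ⟨mod n ⟩
coset⇒≈ a n (k , refl) = a+nk≈a a n k

≈⇒coset : ∀ {a n z} → z ≈ a ⟨mod n ⟩ → z ∈ coset a n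
≈⇒coset {a} {n} {z} (mod (divides k z-a≡kn)) =
  k , trans (lemma a z) (cong (λ i → a + i) (trans z-a≡kn (ℤ.*-comm k (+ n))))
  where
  lemma : ∀ a z → z ≡ a + (z - a)
  lemma = solve-∀

≈-%ℕ : ∀ a n .{{_ : NonZero n}} → a ≈ + (a %ℕ n) ⟨mod n ⟩
≈-%ℕ a n = mod (divides (a /ℕ n)
  (trans (cong (_- + (a %ℕ n)) (a≡a%ℕn+[a/ℕn]*n a n)) (lemma (+ (a %ℕ n)) ((a /ℕ n) * + n))))
  where
  lemma : ∀ r m → r + m - r ≡ m
  lemma = solve-∀

-- The difference has absolute value at most the larger of `r` and `s`, hence below `n`, and the
-- only multiple of `n` in that range is 0.
≈-<⇒≡ : ∀ {r s n} → r ℕ.< n → s ℕ.< n → + r ≈ + s ⟨mod n ⟩ → r ≡ s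
≈-<⇒≡ {r} {s} {n} r<n s<n (mod n∣r-s) = ℤ.+-injective (ℤ.i-j≡0⇒i≡j (+ r) (+ s)
  (ℤ.∣i∣≡0⇒i≡0 (small (∣⇒∣ᵤ n∣r-s) ∣r-s∣<n)))
  where
  ∣r-s∣<n : ∣ + r - + s ∣ ℕ.< n
  ∣r-s∣<n = subst (ℕ._< n) (cong ∣_∣ (sym (ℤ.m-n≡m⊖n r s)))
    (ℕ.≤-<-trans (ℤ.∣m⊝n∣≤m⊔n r s) (ℕ.⊔-pres-<m r<n s<n))

  small : ∀ {k} → n ℕ.∣ k → k ℕ.< n → k ≡ 0
  small {ℕ.zero}  _   _   = refl
  small {ℕ.suc k} n∣k k<n = contradiction n∣k (ℕ.>⇒∤ k<n)

cls-cong : ∀ n .{{_ : NonZero n}} {a b} → a ≈ b ⟨mod n ⟩ → cls n a ≡ cls n b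
cls-cong n {a} {b} a≈b = fromℕ<-cong _ _
  (≈-<⇒≡ (n%ℕd<d a n) (n%ℕd<d b n)
    (≈-trans (≈-sym (≈-%ℕ a n)) (≈-trans a≈b (≈-%ℕ b n))))
  (n%ℕd<d a n) (n%ℕd<d b n)

toℕ-cls : ∀ n .{{_ : NonZero n}} a → + toℕ (cls n a) ≈ a ⟨mod n ⟩
toℕ-cls n a = subst (_≈ a ⟨mod n ⟩) (cong +_ (sym (toℕ-fromℕ< (n%ℕd<d a n))))
  (≈-sym (≈-%ℕ a n))

cls-toℕ : ∀ n .{{_ : NonZero n}} (c : Fin n) → cls n (+ toℕ c) ≡ c
cls-toℕ n c = trans (fromℕ<-cong _ _ (m<n⇒m%n≡m (toℕ<n c)) (n%ℕd<d (+ toℕ c) n) (toℕ<n c))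
  (fromℕ<-toℕ c (toℕ<n c))

-- Primes and prime powers.

prime-∣-^ : ∀ {p} → Prime p → ∀ m r → p ℕ.∣ m ℕ.^ r → p ℕ.∣ m
prime-∣-^ {p} p-prime m ℕ.zero p∣1 =
  contradiction (ℕ.∣1⇒≡1 p∣1) (ℕ.nonTrivial⇒≢1 {{prime⇒nonTrivial p-prime}})
prime-∣-^ p-prime m (ℕ.suc r) p∣ =
  [ id , prime-∣-^ p-prime m r ]′ (euclidsLemma m (m ℕ.^ r) p-prime p∣)

prime-∣-prime : ∀ {p q} → Prime p → Prime q → p ℕ.∣ q → p ≡ q
prime-∣-prime p-prime q-prime p∣q with prime⇒irreducible q-prime p∣q
... | inj₁ p≡1 = contradiction p≡1 (ℕ.nonTrivial⇒≢1 {{prime⇒nonTrivial p-prime}})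
... | inj₂ p≡q = p≡q

-- Elements of `𝒫` carry a primality proof, so identifying those with the same underlying number
-- requires such proofs to agree.
Prime-irrelevant : ∀ {p} (P Q : Prime p) → P ≡ Q
Prime-irrelevant (prime _) (prime _) = refl

𝒫-≡ : {p q : 𝒫} → proj₁ p ≡ proj₁ q → p ≡ q
𝒫-≡ {p , P} {_ , Q} refl = cong (p ,_) (Prime-irrelevant P Q)

_≟_ : (p q : 𝒫) → Dec (p ≡ q)
p ≟ q with proj₁ p ℕ.≟ proj₁ q
... | yes p≡q = yes (𝒫-≡ p≡q)
... | no  p≢q = no (p≢q ∘ cong proj₁)

_∈?_ : (p : 𝒫) (ps : List 𝒫) → Dec (p ∈ₗ ps)
p ∈? ps = Any.any? (p ≟_) ps

1<𝒫 : (p : 𝒫) → 1 ℕ.< proj₁ p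
1<𝒫 p = ℕ.nonTrivial⇒n>1 (proj₁ p) {{prime⇒nonTrivial (proj₂ p)}}

^-monoʳ-∣ : ∀ m {r s} → r ℕ.≤ s → m ℕ.^ r ℕ.∣ m ℕ.^ s
^-monoʳ-∣ m {r} {s} r≤s = ℕ.divides (m ℕ.^ (s ℕ.∸ r))
  (trans (cong (m ℕ.^_) (sym (ℕ.m∸n+n≡m r≤s))) (ℕ.^-distribˡ-+-* m (s ℕ.∸ r) r))

∥-prime-power : ∀ (p : 𝒫) {r s} → proj₁ p ^ s ∥ (proj₁ p ℕ.^ r) → s ≡ r
∥-prime-power p {r} {s} (pˢ∣pʳ , pˢ⁺¹∤pʳ) with ℕ.<-cmp s r
... | tri< s<r _ _ = contradiction (^-monoʳ-∣ (proj₁ p) s<r) pˢ⁺¹∤pʳ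
... | tri≈ _ s≡r _ = s≡r
... | tri> _ _ s>r = contradiction pˢ∣pʳ
  (ℕ.>⇒∤ {{prime^≢0 p r}} (ℕ.^-monoʳ-< (proj₁ p) (1<𝒫 p) s>r))

n<p^n : (p : 𝒫) → ∀ n → n ℕ.< proj₁ p ℕ.^ n
n<p^n p ℕ.zero    = z<s
n<p^n p (ℕ.suc n) = ℕ.≤-<-trans (n<p^n p n) (ℕ.^-monoʳ-< (proj₁ p) (1<𝒫 p) (ℕ.n<1+n n))

-- The Chinese remainder theorem for prime powers.

prime-∤⇒coprime : ∀ {p m} → Prime p → ¬ p ℕ.∣ m → Coprime p m
prime-∤⇒coprime p-prime p∤m (d∣p , d∣m) with prime⇒irreducible p-prime d∣p
... | inj₁ d≡1  = d≡1
... | inj₂ refl = contradiction d∣m p∤m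

-- A Bézout identity writes 1 as a multiple of `m` plus a multiple of `n`; `v` is the first summand.
idempotent : ∀ {m n} → Coprime m n → ∃[ v ] v ≈ 0ℤ ⟨mod m ⟩ × v ≈ 1ℤ ⟨mod n ⟩
idempotent {m} {n} m⊥n with coprime-Bézout m⊥n
... | Bézout.+- x y 1+yn≡xm =
  + x * + m , mod (divides (+ x) (ℤ.+-identityʳ _)) ,
  mod (divides (+ y) (trans (cong (_- 1ℤ) eq) (lemma (+ y * + n))))
  where
  eq : + x * + m ≡ 1ℤ + + y * + n
  eq = trans (sym (ℤ.pos-* x m)) (trans (cong +_ (sym 1+yn≡xm)) (cong (λ i → 1ℤ + i) (ℤ.pos-* y n)))
  lemma : ∀ a → 1ℤ + a - 1ℤ ≡ a
  lemma = solve-∀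
... | Bézout.-+ x y 1+xm≡yn =
  - (+ x * + m) , mod (divides (- (+ x)) (lemma₁ (+ x) (+ m))) ,
  mod (divides (- (+ y)) (trans (lemma₂ (+ x * + m)) (trans (cong -_ eq) (ℤ.neg-distribˡ-* (+ y) (+ n)))))
  where
  eq : 1ℤ + + x * + m ≡ + y * + n
  eq = trans (cong (λ i → 1ℤ + i) (sym (ℤ.pos-* x m))) (trans (cong +_ 1+xm≡yn) (ℤ.pos-* y n))
  lemma₁ : ∀ x m → - (x * m) - 0ℤ ≡ - x * m
  lemma₁ = solve-∀
  lemma₂ : ∀ a → - a - 1ℤ ≡ - (1ℤ + a)
  lemma₂ = solve-∀

-- If v ≡ 0 modulo m and v ≡ 1 modulo n, then w = v ^ e works.
power-idempotent : ∀ {m n} → Coprime m n → ∀ e →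
  ∃[ w ] w ≈ 0ℤ ⟨mod m ℕ.^ e ⟩ × w ≈ 1ℤ ⟨mod n ⟩
power-idempotent {m} {n} m⊥n e = v ^ e , v^e≈0 e , v^e≈1 e
  where
  v = proj₁ (idempotent m⊥n)
  v≈0 = proj₁ (proj₂ (idempotent m⊥n))
  v≈1 = proj₂ (proj₂ (idempotent m⊥n))

  v^e≈0 : ∀ e → v ^ e ≈ 0ℤ ⟨mod m ℕ.^ e ⟩
  v^e≈0 ℕ.zero    = mod (divides 1ℤ refl)
  v^e≈0 (ℕ.suc e) with v≈0 | v^e≈0 e
  ... | mod (divides a v≡am) | mod (divides b v^e≡bm^e) = mod (divides (a * b)
    (trans (minus-zero (v * v ^ e))
      (trans (cong₂ _*_ (trans (sym (minus-zero v)) v≡am) (trans (sym (minus-zero (v ^ e))) v^e≡bm^e))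
        (trans (interchange a (+ m) b (+ (m ℕ.^ e))) (cong (a * b *_) (sym (ℤ.pos-* m (m ℕ.^ e))))))))
    where
    minus-zero : ∀ x → x - 0ℤ ≡ x
    minus-zero = ℤ.+-identityʳ
    interchange : ∀ a b c d → (a * b) * (c * d) ≡ (a * c) * (b * d)
    interchange = solve-∀

  v^e≈1 : ∀ e → v ^ e ≈ 1ℤ ⟨mod n ⟩
  v^e≈1 ℕ.zero    = ≈-refl
  v^e≈1 (ℕ.suc e) = ≈-*-cong v≈1 (v^e≈1 e)

override : List 𝒫 → ℤ → (𝒫 → ℤ) → 𝒫 → ℤ
override P x t p with p ∈? P
... | yes _ = x
... | no  _ = t p

override-∈ : ∀ {p P x t} → p ∈ₗ P → override P x t p ≡ x
override-∈ {p} {P} p∈P with p ∈? P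
... | yes _   = refl
... | no  p∉P = contradiction p∈P p∉P

override-∉ : ∀ {p P x t} → ¬ p ∈ₗ P → override P x t p ≡ t p
override-∉ {p} {P} p∉P with p ∈? P
... | yes p∈P = contradiction p∈P p∉P
... | no  _   = refl

module _ (e : 𝒫 → ℕ) where

  modulus : 𝒫 → ℕ
  modulus p = proj₁ p ℕ.^ e p

  moduli : List 𝒫 → ℕ
  moduli ps = product (map modulus ps)

  modulus∣moduli : ∀ {p ps} → p ∈ₗ ps → modulus p ℕ.∣ moduli ps
  modulus∣moduli p∈ps = ∈⇒∣product (∈-map⁺ modulus p∈ps)

  moduli≢0 : ∀ ps → NonZero (moduli ps)
  moduli≢0 []       = _
  moduli≢0 (p ∷ ps) = ℕ.m*n≢0 _ _ {{prime^≢0 p (e p)}} {{moduli≢0 ps}}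

  -- By Euclid's lemma `p` divides one factor, a power of a listed prime, and so equals that prime.
  -- Hence a prime outside the list is coprime to the product, as the induction in `crt` needs.
  ∣moduli⇒∈ : ∀ {p} ps → proj₁ p ℕ.∣ moduli ps → p ∈ₗ ps
  ∣moduli⇒∈ {p} [] p∣1 =
    contradiction (ℕ.∣1⇒≡1 p∣1) (ℕ.nonTrivial⇒≢1 {{prime⇒nonTrivial (proj₂ p)}})
  ∣moduli⇒∈ {p} (q ∷ ps) p∣ with euclidsLemma (modulus q) (moduli ps) (proj₂ p) p∣
  ... | inj₁ p∣q^e = here (𝒫-≡ (prime-∣-prime (proj₂ p) (proj₂ q)
                       (prime-∣-^ (proj₂ p) (proj₁ q) (e q) p∣q^e)))
  ... | inj₂ p∣ps  = there (∣moduli⇒∈ ps p∣ps)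

  module _ (t : 𝒫 → ℤ) where

    Solves : ℤ → List 𝒫 → Set
    Solves z ps = ∀ {p} → p ∈ₗ ps → z ≈ t p ⟨mod modulus p ⟩

    crt : ∀ ps → ∃[ z ] Solves z ps
    crt []       = 0ℤ , λ ()
    crt (p ∷ ps) with crt ps | p ∈? ps
    -- A repeated prime adds no condition, as its residue and exponent depend on the prime alone.
    ... | z , z-solves | yes p∈ps = z , λ { (here refl) → z-solves p∈ps ; (there q∈ps) → z-solves q∈ps }
    ... | z , z-solves | no  p∉ps
      with w , mod w≈0 , mod w≈1 ← power-idempotent (prime-∤⇒coprime (proj₂ p) (p∉ps ∘ ∣moduli⇒∈ ps)) (e p)
      = z′ , λ { (here refl)  → z′≈t
               ; (there q∈ps) → ≈-trans (≈-weaken (modulus∣moduli q∈ps) z′≈z) (z-solves q∈ps) }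
      where
      -- `w` is 0 modulo the new modulus and 1 modulo the product of the old ones, so this
      -- interpolates between `t p` and `z`.
      z′ = t p + w * (z - t p)

      z′≈t : z′ ≈ t p ⟨mod modulus p ⟩
      z′≈t = mod (subst (+ modulus p ∣_) (lemma (t p) w z) (∣m⇒∣m*n (z - t p) w≈0))
        where
        lemma : ∀ t w z → (w - 0ℤ) * (z - t) ≡ t + w * (z - t) - t
        lemma = solve-∀

      z′≈z : z′ ≈ z ⟨mod moduli ps ⟩
      z′≈z = mod (subst (+ moduli ps ∣_) (lemma (t p) w z) (∣m⇒∣m*n (z - t p) w≈1))
        where
        lemma : ∀ t w z → (w - 1ℤ) * (z - t) ≡ t + w * (z - t) - z
        lemma = solve-∀

    -- The product of the moduli is nonzero, and adding enough copies of it changes no residue.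
    -- Positive solutions serve ℕ₁ as well as ℤ.
    crt-positive : ∀ ps → ∃[ z ] 0ℤ < z × Solves z ps
    crt-positive ps with z , z-solves ← crt ps = z′ , 0<z′ , z′-solves
      where
      M = moduli ps
      k = ℕ.suc ∣ z ∣
      z′ = z + + M * + k

      0<z′ : 0ℤ < z′
      0<z′ = ℤ.<-≤-trans (0<z+suc∣z∣ z) (ℤ.+-monoʳ-≤ z
        (subst (+ k ≤_) (ℤ.pos-* M k) (+≤+ (ℕ.m≤n*m k M {{moduli≢0 ps}}))))
        where
        0<z+suc∣z∣ : ∀ z → 0ℤ < z + + ℕ.suc ∣ z ∣
        0<z+suc∣z∣ (+ n)      = +<+ (ℕ.<-≤-trans z<s (ℕ.m≤n+m _ n))
        0<z+suc∣z∣ -[1+ n ] = subst (0ℤ <_)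
          (sym (trans (ℤ.⊖-≥ (ℕ.n≤1+n (ℕ.suc n))) (cong +_ (ℕ.m+n∸n≡m 1 (ℕ.suc n))))) (+<+ z<s)

      z′-solves : Solves z′ ps
      z′-solves p∈ps =
        ≈-trans (≈-weaken (modulus∣moduli p∈ps) (a+nk≈a z M (+ k))) (z-solves p∈ps)

-- Induced topologies, connectedness and local properties.

-- The initial topology along `f`, given by characterising the open sets, so that ℤ, ℕ₁ and their
-- subspaces all become instances.
record IsInducedBy {X Y : Set} (f : X → Y) (S : Topology Y) (T : Topology X) : Set₁ where
  constructor induced
  field open⇔ : ∀ V → IsOpen T V ⇔ (∃[ W ] IsOpen S W × V ≐ (f ⊢ W))

induced-id : {X : Set} (T : Topology X) → IsInducedBy id T T
induced-id T = induced λ V →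
  mk⇔ (λ o → V , o , ≐-refl) λ { (W , o , V≐W) → IsOpen-≐ T (≐-sym V≐W) o }

preimage-open : {X Y : Set} {f : X → Y} {S : Topology Y} {T : Topology X} →
  IsInducedBy f S T → ∀ W → IsOpen S W → IsOpen T (f ⊢ W)
preimage-open {f = f} (induced open⇔) W oW = Equivalence.from (open⇔ (f ⊢ W)) (W , oW , ≐-refl)

induced-subspace : {X Y : Set} {f : X → Y} {S : Topology Y} {T : Topology X} →
  IsInducedBy f S T → (A : Pred X 0ℓ) → IsInducedBy (f ∘ proj₁) S (subspace T A)
induced-subspace {f = f} ind@(induced open⇔) A = induced λ V → mk⇔
  (λ { (V′ , o , V⊆ , ⊆V) → let (W , oW , V′⊆ , ⊆V′) = Equivalence.to (open⇔ V′) o in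
       W , oW , V′⊆ ∘ V⊆ , ⊆V ∘ ⊆V′ })
  (λ { (W , oW , V≐) → (f ⊢ W) , preimage-open ind W oW , V≐ })

generatedBy-basic : {X I : Set} (S : I → Pred X 0ℓ) → ∀ is → IsOpen (generatedBy S) (⋂[ S ] is)
generatedBy-basic S is = Unit , (λ _ → is) , (λ x∈ → tt , x∈) , proj₂

open⇒basic : {X Y I : Set} {f : X → Y} {S : I → Pred Y 0ℓ} {T : Topology X} →
  IsInducedBy f (generatedBy S) T → ∀ {V x} → IsOpen T V → x ∈ V →
  ∃[ is ] f x ∈ ⋂[ S ] is × (f ⊢ ⋂[ S ] is) ⊆ V
open⇒basic (induced open⇔) {V} oV x∈V
  with W , (J , list , W⊆ , ⊆W) , V⊆W , W⊆V ← Equivalence.to (open⇔ V) oV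
  with j , fx∈ ← W⊆ (V⊆W x∈V)
  = list j , fx∈ , λ fy∈ → W⊆V (⊆W (j , fy∈))

-- A point in the closures of both halves of a separation lies in one half, which is then an open
-- neighbourhood meeting the other half.
superconnected⇒connected : {X : Set} (T : Topology X) → Superconnected T → Connected T
superconnected⇒connected {X} T sc (V , W , oV , oW , V≠∅ , W≠∅ , V∩W=∅ , V∪W=U) =
  let (x , x∈cl) = sc 2 VW (λ { fzero → oV ; (fsuc _) → oW }) (λ { fzero → V≠∅ ; (fsuc _) → W≠∅ }) in
  [ (λ x∈V → let (y , y∈V , y∈W) = x∈cl (fsuc fzero) V oV x∈V in V∩W=∅ y (y∈V , y∈W))
  , (λ x∈W → let (y , y∈W , y∈V) = x∈cl fzero W oW x∈W in V∩W=∅ y (y∈V , y∈W))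
  ]′ (V∪W=U x)
  where
  VW : Fin 2 → Pred X 0ℓ
  VW fzero    = V
  VW (fsuc _) = W

module _ (P : ∀ {X : Set} → Topology X → Set₁) {X : Set} (T : Topology X) where

  locally-map : {Q : ∀ {X : Set} → Topology X → Set₁} →
    (∀ {X} (T : Topology X) → P T → Q T) → Locally P T → Locally Q T
  locally-map P⇒Q loc x = let (𝓕 , base , opens) = loc x in
    𝓕 , base , λ V V∈𝓕 → let (oV , pV) = opens V V∈𝓕 in oV , P⇒Q (subspace T V) pV

  -- All open sets around `x` with property `P` are taken as the base at `x`.
  locally : (∀ {V x} → IsOpen T V → x ∈ V →
               ∃[ W ] IsOpen T W × x ∈ W × W ⊆ V × P (subspace T W)) →
            Locally P T
  locally small x =
    (λ W → x ∈ W × IsOpen T W × P (subspace T W)) ,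
    ((λ { W (x∈W , oW , _) → W , oW , x∈W , λ v → v }) ,
     (λ { N (V , oV , x∈V , V⊆N) → let (W , oW , x∈W , W⊆V , pW) = small oV x∈V in
          W , (x∈W , oW , pW) , V⊆N ∘ W⊆V })) ,
    λ { W (_ , oW , pW) → oW , pW }

  locally⁻¹ : Locally P T → ∀ {V x} → IsOpen T V → x ∈ V →
              ∃[ W ] IsOpen T W × x ∈ W × W ⊆ V × P (subspace T W)
  locally⁻¹ loc {V} {x} oV x∈V =
    let (𝓕 , (nbhd , base) , opens) = loc x
        (W , W∈𝓕 , W⊆V) = base V (V , oV , x∈V , λ v → v)
        (_ , _ , x∈W₀ , W₀⊆W) = nbhd W W∈𝓕
        (oW , pW) = opens W W∈𝓕
    in W , oW , W₀⊆W x∈W₀ , W⊆V , pW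

-- The Golomb sets at a single prime.

module _ (𝓑 : GolombSystem) where
  open GolombSystem 𝓑

  -- The negation of escaping `p`, tested at the exponent `γ p`, where membership for all higher
  -- exponents is decided.
  Avoids : 𝒫 → ℤ → Set
  Avoids p z = clsₚ p (γ p) z ∉ₛ B₀ p

  Avoids-resp : ∀ p {a b r} → γ p ℕ.≤ r → a ≈ b ⟨mod proj₁ p ℕ.^ r ⟩ → Avoids p a → Avoids p b
  Avoids-resp p γ≤r a≈b = subst (_∉ₛ B₀ p)
    (cls-cong (proj₁ p ℕ.^ γ p) {{prime^≢0 p (γ p)}}
      (≈-weaken (^-monoʳ-∣ (proj₁ p) γ≤r) a≈b))

  clsₚ-toℕ : ∀ p (c : Fin (proj₁ p ℕ.^ γ p)) → clsₚ p (γ p) (+ toℕ c) ≡ c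
  clsₚ-toℕ p = cls-toℕ (proj₁ p ℕ.^ γ p) {{prime^≢0 p (γ p)}}

  πₚ-clsₚ : ∀ p {r s} a → s ℕ.≤ r → πₚ (proj₁ p ℕ.^ r) p s (clsₚ p r a) ≡ clsₚ p s a
  πₚ-clsₚ p {r} {s} a s≤r = cls-cong (proj₁ p ℕ.^ s) {{prime^≢0 p s}}
    (≈-weaken (^-monoʳ-∣ (proj₁ p) s≤r)
      (toℕ-cls (proj₁ p ℕ.^ r) {{prime^≢0 p r}} a))

  B-primePower-clsₚ : ∀ p r a → γ p ℕ.≤ r →
    clsₚ p r a ∈ B-primePower p r ⇔ clsₚ p (γ p) a ∈ₛ B₀ p
  B-primePower-clsₚ p r a γ≤r with γ p ℕ.≤? r
  ... | yes _   = mk⇔ (subst (_∈ₛ B₀ p) (πₚ-clsₚ p {r} a γ≤r)) (subst (_∈ₛ B₀ p) (sym (πₚ-clsₚ p {r} a γ≤r)))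
  ... | no  γ≰r = contradiction γ≤r γ≰r

  -- Only the prime `p` divides `p ^ r`, with exact exponent `r`, so membership in `B` comes down to
  -- a single condition.
  ∉B⇒Avoids : ∀ p r a → γ p ℕ.≤ r → ¬ clsₚ p r a ∈ B (proj₁ p ℕ.^ r) → Avoids p a
  ∉B⇒Avoids p r a γ≤r a∉B a∈B₀ = a∉B λ q s q∣pʳ qˢ∥pʳ →
    at q s (𝒫-≡ (prime-∣-prime (proj₂ q) (proj₂ p) (prime-∣-^ (proj₂ q) (proj₁ p) r q∣pʳ))) qˢ∥pʳ
    where
    at : ∀ q s → q ≡ p → proj₁ q ^ s ∥ (proj₁ p ℕ.^ r) →
         πₚ (proj₁ p ℕ.^ r) q s (clsₚ p r a) ∈ B-primePower q s
    at q s refl pˢ∥pʳ with refl ← ∥-prime-power p {r} {s} pˢ∥pʳ =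
      subst (_∈ B-primePower p r) (sym (πₚ-clsₚ p {r} a ℕ.≤-refl))
        (Equivalence.from (B-primePower-clsₚ p r a γ≤r) a∈B₀)

  -- Modulo `p ^ 0` there is one class, and it lies in the nonempty set `B₀ p`.
  γ>0 : ∀ p a → Avoids p a → 0 ℕ.< γ p
  γ>0 p a a∉B₀ = ℕ.n≢0⇒n>0 λ γ≡0 → a∉B₀ (subst (_∈ₛ B₀ p) (sole γ≡0 _ _) (proj₂ (nonempty p)))
    where
    sole : ∀ {r} → r ≡ 0 → (c d : Fin (proj₁ p ℕ.^ r)) → c ≡ d
    sole refl fzero fzero = refl

  -- `B` constrains only primes dividing the modulus; `p` divides `p ^ r` because `r` is at least
  -- `γ p`, which is positive.
  Avoids⇒∉B : ∀ p r a → γ p ℕ.≤ r → Avoids p a → ¬ clsₚ p r a ∈ B (proj₁ p ℕ.^ r)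
  Avoids⇒∉B p r a γ≤r a∉B₀ a∈B = a∉B₀ (Equivalence.to (B-primePower-clsₚ p r a γ≤r)
    (subst (_∈ B-primePower p r) (πₚ-clsₚ p {r} a ℕ.≤-refl)
      (a∈B p r p∣pʳ (ℕ.∣-refl , λ pʳ⁺¹∣pʳ → ℕ.>⇒∤ {{prime^≢0 p r}}
        (ℕ.^-monoʳ-< (proj₁ p) (1<𝒫 p) (ℕ.n<1+n r)) pʳ⁺¹∣pʳ))))
    where
    p∣pʳ : proj₁ p ℕ.∣ proj₁ p ℕ.^ r
    p∣pʳ = subst (ℕ._∣ proj₁ p ℕ.^ r) (ℕ.^-identityʳ (proj₁ p))
      (^-monoʳ-∣ (proj₁ p) (ℕ.≤-trans (γ>0 p a a∉B₀) γ≤r))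

  ∃-¬Avoids : ∀ p → ∃[ z ] ¬ Avoids p z
  ∃-¬Avoids p = let (c , c∈B₀) = nonempty p in
    + toℕ c , λ c∉B₀ → c∉B₀ (subst (_∈ₛ B₀ p) (sym (clsₚ-toℕ p c)) c∈B₀)

  ∃-Avoids : ∀ p → 0 ℕ.< γ p → ∃[ z ] 0ℤ < z × Avoids p z
  ∃-Avoids p 0<γ
    -- Membership in a subset of a finite set is decidable, so properness yields an explicit missing
    -- class.
    with c , c∉B₀ ← ¬∀⟶∃¬ _ (_∈ₛ B₀ p) (_∈ₛ? B₀ p)
                      (λ all → proper p 0<γ (⊆-antisym ⊆⊤ (λ {x} _ → all x)))
    = z , +<+ (ℕ.<-≤-trans (ℕ.m^n>0 (proj₁ p) {{prime⇒nonZero (proj₂ p)}} (γ p)) (ℕ.m≤n+m _ (toℕ c))) ,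
      Avoids-resp p ℕ.≤-refl
        (≈-sym (+-≈ (+ toℕ c) ℕ.∣-refl))
        (c∉B₀ ∘ subst (_∈ₛ B₀ p) (clsₚ-toℕ p c))
    where
    n = proj₁ p ℕ.^ γ p
    -- Adding the modulus makes the representative positive even when `toℕ c` is 0.
    z = + (toℕ c ℕ.+ n)

  -- Basic open sets of the Kirch topology.

  module _ (K : KirchFunction 𝓑) where
    open KirchFunction K

    class : ℤ → ℕ → Pred ℤ 0ℓ
    class a n z = z ≈ a ⟨mod n ⟩

    class-open : ∀ {p r a} → γ p ℕ.≤ r → [ r ] ≤⁺ κ p → Avoids p a →
                 IsOpen (𝒯 𝓑 K) (class a (proj₁ p ℕ.^ r))
    class-open {p} {r} {a} γ≤r r≤κ a∉B₀ = IsOpen-≐ (𝒯 𝓑 K)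
      ((λ { (z∈coset ∷ []) → coset⇒≈ a _ z∈coset }) , λ z≈a → ≈⇒coset z≈a ∷ [])
      (generatedBy-basic (subbase 𝓑 K) (i ∷ []))
      where
      i : SubbaseIndex 𝓑 K
      i = record { a = a ; p = p ; r = r ; γ≤r = γ≤r ; r≤κ = r≤κ ; a∉B = Avoids⇒∉B p r a γ≤r a∉B₀ }

    -- A common period of finitely many subbasic cosets; translation by it gives a second point of
    -- their intersection.
    indexModulus : List (SubbaseIndex 𝓑 K) → ℕ
    indexModulus is = product (map (λ i → proj₁ (p i) ℕ.^ r i) is)
      where open SubbaseIndex

    indexModulus≢0 : ∀ is → NonZero (indexModulus is)
    indexModulus≢0 []       = _
    indexModulus≢0 (i ∷ is) = ℕ.m*n≢0 _ _ {{prime^≢0 p r}} {{indexModulus≢0 is}}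
      where open SubbaseIndex i

    indexModulus-shift : ∀ is {z} → z ∈ ⋂[ subbase 𝓑 K ] is → z + + indexModulus is ∈ ⋂[ subbase 𝓑 K ] is
    indexModulus-shift is {z} z∈is = All.tabulate λ {i} i∈is → let open SubbaseIndex i in
      ≈⇒coset (≈-trans (+-≈ z (∈⇒∣product (∈-map⁺ _ i∈is))) (coset⇒≈ a _ (All.lookup z∈is i∈is)))

    -- Finite `κ`: boxes and local superconnectedness.

    module Finite (k : 𝒫 → ℕ) (κ≡k : ∀ p → κ p ≡ [ k p ]) where

      γ≤k : ∀ p → γ p ℕ.≤ k p
      γ≤k p with [ γ≤k ] ← subst ([ γ p ] ≤⁺_) (κ≡k p) (γ≤κ p) = γ≤k

      box : List 𝒫 → ℤ → Pred ℤ 0ℓ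
      box P x z = ∀ p → p ∈ₗ P → z ≈ x ⟨mod modulus k p ⟩

      box-open : ∀ P x → (∀ {p} → p ∈ₗ P → Avoids p x) → IsOpen (𝒯 𝓑 K) (box P x)
      box-open []      x _      = IsOpen-≐ (𝒯 𝓑 K) ((λ _ _ ()) , _) (IsOpen-U (𝒯 𝓑 K))
      box-open (p ∷ P) x avoids = IsOpen-≐ (𝒯 𝓑 K)
        ((λ { (z≈x , z∈box) q (here refl) → z≈x ; (z≈x , z∈box) q (there q∈P) → z∈box q q∈P }) ,
         (λ z∈box → z∈box p (here refl) , λ q q∈P → z∈box q (there q∈P)))
        (IsOpen-∩ (𝒯 𝓑 K)
          (class-open (γ≤k p) (subst ([ k p ] ≤⁺_) (sym (κ≡k p)) [ ℕ.≤-refl ]) (avoids (here refl)))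
          (box-open P x (avoids ∘ there)))

      -- A coset modulo `p ^ r` containing `x` contains the class of `x` modulo `p ^ k p`, since `r`
      -- is at most `k p`; and `x` inherits `Avoids p` from its representative `a`.
      basic⇒box : ∀ is {x} → x ∈ ⋂[ subbase 𝓑 K ] is →
        ∃[ P ] (∀ {p} → p ∈ₗ P → Avoids p x) × box P x ⊆ ⋂[ subbase 𝓑 K ] is
      basic⇒box []           []         = [] , (λ ()) , λ _ → []
      basic⇒box (i ∷ is) {x} (x∈i ∷ x∈is)
        with P , avoids , box⊆ ← basic⇒box is x∈is = p ∷ P ,
          (λ { (here refl) → Avoids-resp p γ≤r (≈-sym (coset⇒≈ a _ x∈i)) (∉B⇒Avoids p r a γ≤r a∉B)
             ; (there q∈P) → avoids q∈P }) ,
          (λ z∈box → ≈⇒coset (≈-trans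
              (≈-weaken (^-monoʳ-∣ (proj₁ p) r≤k) (z∈box p (here refl))) (coset⇒≈ a _ x∈i))
            ∷ box⊆ (λ q q∈P → z∈box q (there q∈P)))
        where
        open SubbaseIndex i
        r≤k : r ℕ.≤ k p
        r≤k with [ r≤k ] ← subst ([ r ] ≤⁺_) (κ≡k p) r≤κ = r≤k

      open⇒box : {X : Set} {f : X → ℤ} {T : Topology X} → IsInducedBy f (𝒯 𝓑 K) T →
        ∀ {V x} → IsOpen T V → x ∈ V →
        ∃[ P ] (∀ {p} → p ∈ₗ P → Avoids p (f x)) × (f ⊢ box P (f x)) ⊆ V
      open⇒box ind oV x∈V
        with is , fx∈is , is⊆V ← open⇒basic ind oV x∈V
        with P , avoids , box⊆is ← basic⇒box is fx∈is
        = P , avoids , λ fy∈box → is⊆V (box⊆is fy∈box)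

      -- Residues of `x` are prescribed at `P`, and residues from the Golomb sets at the other
      -- primes of `R`.
      escape : ∀ P R x →
        ∃[ z ] 0ℤ < z × z ∈ box P x × (∀ {p} → p ∈ₗ R → ¬ p ∈ₗ P → ¬ Avoids p z)
      escape P R x = let (z , 0<z , z-solves) = crt-positive k t (P ++ R) in z , 0<z ,
        (λ p p∈P → subst (z ≈_⟨mod modulus k p ⟩) (override-∈ p∈P) (z-solves (∈-++⁺ˡ p∈P))) ,
        λ {p} p∈R p∉P avoids → proj₂ (∃-¬Avoids p) (subst (Avoids p) (override-∉ p∉P)
          (Avoids-resp p (γ≤k p) (z-solves (∈-++⁺ʳ P p∈R)) avoids))
        where
        t = override P x (proj₁ ∘ ∃-¬Avoids)

      -- The conditions from `Q` and `R` could clash only at a common prime; such a prime lies in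
      -- `P`, where `v` and `w` both agree with `x`.
      box-meet : ∀ P Q R {x v w} → v ∈ box P x → w ∈ box P x →
        (∀ {p} → p ∈ₗ Q → p ∈ₗ R → p ∈ₗ P) →
        ∃[ z ] 0ℤ < z × z ∈ box P x × z ∈ box Q v × z ∈ box R w
      box-meet P Q R {x} {v} {w} v∈P w∈P Q∩R⊆P =
        let (z , 0<z , z-solves) = crt-positive k t (P ++ Q ++ R) in z , 0<z ,
        (λ p p∈P → ≈-trans (z-solves (∈-++⁺ˡ p∈P)) (t≈x p∈P)) ,
        (λ p p∈Q → ≈-trans (z-solves (∈-++⁺ʳ P (∈-++⁺ˡ p∈Q))) (t≈v p∈Q)) ,
        (λ p p∈R → subst (z ≈_⟨mod modulus k p ⟩) (override-∈ p∈R) (z-solves (∈-++⁺ʳ P (∈-++⁺ʳ Q p∈R))))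
        where
        -- At the primes of `P` either choice of residue is congruent to `x`.
        t = override R w (λ _ → v)

        t≈x : ∀ {p} → p ∈ₗ P → t p ≈ x ⟨mod modulus k p ⟩
        t≈x {p} p∈P with p ∈? R
        ... | yes _ = w∈P p p∈P
        ... | no  _ = v∈P p p∈P

        t≈v : ∀ {p} → p ∈ₗ Q → t p ≈ v ⟨mod modulus k p ⟩
        t≈v {p} p∈Q with p ∈? R
        ... | yes p∈R = ≈-trans (w∈P p (Q∩R⊆P p∈Q p∈R)) (≈-sym (v∈P p (Q∩R⊆P p∈Q p∈R)))
        ... | no  _   = ≈-refl

      -- `Y` stands for a box in ℤ or its trace on ℕ₁.
      module _ {Y : Set} {g : Y → ℤ} {S : Topology Y} (ind : IsInducedBy g (𝒯 𝓑 K) S)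
        (P : List 𝒫) (x : ℤ) (in-box : ∀ y → g y ∈ box P x)
        (onto : ∀ {z} → 0ℤ < z → z ∈ box P x → ∃[ y ] g y ≡ z) where

        boxes-meet : ∀ Q R y u → (∀ {p} → p ∈ₗ Q → p ∈ₗ R → p ∈ₗ P) →
          (g ⊢ box Q (g y)) ≬ (g ⊢ box R (g u))
        boxes-meet Q R y u Q∩R⊆P =
          let (z , 0<z , z∈P , z∈Q , z∈R) = box-meet P Q R (in-box y) (in-box u) Q∩R⊆P
              (v , gv≡z) = onto 0<z z∈P
          in v , subst (box Q (g y)) (sym gv≡z) z∈Q , subst (box R (g u)) (sym gv≡z) z∈R

        escape-box : ∀ R → ∃[ y ] (∀ {p} → p ∈ₗ R → ¬ p ∈ₗ P → ¬ Avoids p (g y))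
        escape-box R =
          let (z , 0<z , z∈P , escapes) = escape P R x
              (y , gy≡z) = onto 0<z z∈P
          in y , λ {p} p∈R p∉P → subst (λ z → ¬ Avoids p z) (sym gy≡z) (escapes p∈R p∉P)

        -- Each `V i` contains a box with primes `R i`, and `y₀` escapes all of these primes outside
        -- `P`. A box around `y₀` inside a given neighbourhood uses only primes that `y₀` does not
        -- escape, so it shares with `R i` only primes of `P`, and the two boxes meet.
        box-superconnected : Superconnected S
        box-superconnected n V oV V≠∅ =
          let (y₀ , escapes) = escape-box (concatMap R (allFin n)) in
          y₀ , λ i W oW y₀∈W →
            let (Q , avoids , boxQ⊆W) = open⇒box ind oW y₀∈W
                (y , y∈Q , y∈R) = boxes-meet Q (R i) y₀ (u i) λ {p} p∈Q p∈R →
                  decidable-stable (p ∈? P) λ p∉P →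
                    escapes (∈-concatMap⁺ R (Any.map (λ { refl → p∈R }) (∈-allFin i))) p∉P (avoids p∈Q)
            in y , boxQ⊆W y∈Q , boxR⊆V i y∈R
          where
          u : Fin n → Y
          u i = proj₁ (V≠∅ i)

          R : Fin n → List 𝒫
          R i = proj₁ (open⇒box ind (oV i) (proj₂ (V≠∅ i)))

          boxR⊆V : ∀ i → (g ⊢ box (R i) (g (u i))) ⊆ V i
          boxR⊆V i = proj₂ (proj₂ (open⇒box ind (oV i) (proj₂ (V≠∅ i))))

      locally-superconnected : {X : Set} {f : X → ℤ} {T : Topology X} →
        IsInducedBy f (𝒯 𝓑 K) T → (∀ {z} → 0ℤ < z → ∃[ x ] f x ≡ z) → LocallySuperconnected T
      locally-superconnected {f = f} {T} ind onto = locally Superconnected T λ {V} {x} oV x∈V →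
        let (P , avoids , box⊆V) = open⇒box ind oV x∈V
            W = f ⊢ box P (f x)
        in W , preimage-open ind (box P (f x)) (box-open P (f x) avoids) , (λ _ _ → ≈-refl) , box⊆V ,
           box-superconnected (induced-subspace ind W) P (f x) proj₂
             (λ {z} 0<z z∈box → let (x′ , fx′≡z) = onto 0<z in
                (x′ , subst (box P (f x)) (sym fx′≡z) z∈box) , fx′≡z)

    -- Infinite `κ p`: failure of local connectedness.

    locallyConnected⇒≢∞ : {X : Set} {f : X → ℤ} {T : Topology X} →
      IsInducedBy f (𝒯 𝓑 K) T → (∀ {z} → 0ℤ < z → ∃[ x ] f x ≡ z) →
      LocallyConnected T → ∀ p → κ p ≢ ∞
    locallyConnected⇒≢∞ {X} {f} {T} ind onto lc p κ≡∞ =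
      -- A Kirch function vanishes wherever `γ` does, so `γ p` is positive here.
      let (a , 0<a , a-avoids) = ∃-Avoids p (ℕ.n≢0⇒n>0 γ≢0)
          (x , fx≡a) = onto 0<a
          x-avoids = subst (Avoids p) (sym fx≡a) a-avoids
          -- Inside one class modulo `p ^ γ p` every point satisfies `Avoids p`, so its classes
          -- modulo all higher powers of `p` are open.
          (V , oV , x∈V , V⊆ball , V-connected) = locally⁻¹ Connected T lc
            (preimage-open ind (class (f x) (q (γ p))) (class-open ℕ.≤-refl (≤κ (γ p)) x-avoids)) ≈-refl
          (is , x∈is , is⊆V) = open⇒basic ind oV x∈V
      in split x (subst (0ℤ <_) (sym fx≡a) 0<a) x-avoids V x∈V V⊆ball is x∈is is⊆V V-connected
      where
      q : ℕ → ℕ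
      q r = proj₁ p ℕ.^ r

      γ≢0 : γ p ≢ 0
      γ≢0 γ≡0 with () ← trans (sym κ≡∞) (κ≡0 p γ≡0)

      ≤κ : ∀ r → [ r ] ≤⁺ κ p
      ≤κ r = subst ([ r ] ≤⁺_) (sym κ≡∞) ([ r ] ≤⊤⁺)

      split : ∀ x → 0ℤ < f x → Avoids p (f x) → ∀ V → x ∈ V → V ⊆ (f ⊢ class (f x) (q (γ p))) →
        ∀ is → f x ∈ ⋂[ subbase 𝓑 K ] is → (f ⊢ ⋂[ subbase 𝓑 K ] is) ⊆ V → ¬ Connected (subspace T V)
      split x 0<fx x-avoids V x∈V V⊆ball is x∈is is⊆V V-connected = V-connected
        ((f∘proj₁ ⊢ class (f x) (q r)) , (f∘proj₁ ⊢ rest) ,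
         preimage-open indV (class (f x) (q r)) (class-open γ≤r (≤κ r) x-avoids) ,
         preimage-open indV rest (IsOpen-⋃ (𝒯 𝓑 K) λ { (b , b≈ , _) →
           class-open γ≤r (≤κ r) (Avoids-resp p ℕ.≤-refl (≈-sym b≈) x-avoids) }) ,
         ((x , x∈V) , ≈-refl) ,
         ((y , y∈V) , (f y , V⊆ball y∈V , y≉x) , ≈-refl) ,
         (λ { _ (z≈x , (b , _ , b≉x) , z≈b) → b≉x (≈-trans (≈-sym z≈b) z≈x) }) ,
         λ { (z , z∈V) → cover z z∈V (f z ≈? f x ⟨mod q r ⟩) })
        where
        f∘proj₁ : ∃ V → ℤ
        f∘proj₁ = f ∘ proj₁

        indV = induced-subspace ind V
        M = indexModulus is
        -- The summand `M` ensures `M < p ^ r`, and the summand `γ p` makes classes modulo `p ^ r`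
        -- eligible as open sets.
        r = M ℕ.+ γ p
        γ≤r = ℕ.m≤n+m (γ p) M

        -- The complement of the class of `f x` within the ball, written as a union of classes so
        -- that it is visibly open.
        rest : Pred ℤ 0ℓ
        rest = ⋃[ b ∶ (∃[ b ] (b ≈ f x ⟨mod q (γ p) ⟩ × ¬ b ≈ f x ⟨mod q r ⟩)) ] class (proj₁ b) (q r)

        -- Translation by the period `M` stays inside `V`, but leaves the class of `f x` modulo
        -- `p ^ r` because `0 < M < p ^ r`.
        y : X
        y = proj₁ (onto (0<a+n M 0<fx))

        fy≡fx+M : f y ≡ f x + + M
        fy≡fx+M = proj₂ (onto (0<a+n M 0<fx))

        y∈V : y ∈ V
        y∈V = is⊆V (subst (⋂[ subbase 𝓑 K ] is) (sym fy≡fx+M) (indexModulus-shift is x∈is))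

        y≉x : ¬ f y ≈ f x ⟨mod q r ⟩
        y≉x (mod q∣y-x) = ℕ.>⇒∤ {{indexModulus≢0 is}} M<qʳ
          (∣⇒∣ᵤ (subst (+ q r ∣_) (trans (cong (_- f x) fy≡fx+M) (lemma (f x) (+ M))) q∣y-x))
          where
          M<qʳ : M ℕ.< q r
          M<qʳ = ℕ.<-≤-trans (n<p^n p M) (ℕ.^-monoʳ-≤ (proj₁ p) {{prime⇒nonZero (proj₂ p)}} (ℕ.m≤m+n M (γ p)))
          lemma : ∀ a m → a + m - a ≡ m
          lemma = solve-∀

        cover : ∀ z → z ∈ V → Dec (f z ≈ f x ⟨mod q r ⟩) → f z ∈ class (f x) (q r) ⊎ f z ∈ rest
        cover z z∈V (yes z≈x) = inj₁ z≈x
        cover z z∈V (no  z≉x) = inj₂ ((f z , V⊆ball z∈V , z≉x) , ≈-refl)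

theorem2p37 : (𝓑 : GolombSystem) (K : KirchFunction 𝓑) →
    (LocallyConnected (𝒯 𝓑 K) ⇔ κ<∞ 𝓑 K) ×
    (LocallyConnected (𝒯-ℕ₁ 𝓑 K) ⇔ κ<∞ 𝓑 K) ×
    (κ<∞ 𝓑 K →
    LocallySuperconnected (𝒯 𝓑 K) × LocallySuperconnected (𝒯-ℕ₁ 𝓑 K))
theorem2p37 𝓑 K =
  mk⇔ (finite indℤ (λ {z} _ → z , refl)) (connected (𝒯 𝓑 K) ∘ proj₁ ∘ superconnected) ,
  mk⇔ (finite indℕ₁ (λ {z} 0<z → (z , 0<z) , refl)) (connected (𝒯-ℕ₁ 𝓑 K) ∘ proj₂ ∘ superconnected) ,
  superconnected
  where
  open KirchFunction K

  -- The maps to ℤ are the identity and the inclusion of ℕ₁; both attain every positive integer.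
  indℤ = induced-id (𝒯 𝓑 K)
  indℕ₁ = induced-subspace indℤ (0ℤ <_)

  superconnected : κ<∞ 𝓑 K → LocallySuperconnected (𝒯 𝓑 K) × LocallySuperconnected (𝒯-ℕ₁ 𝓑 K)
  superconnected κ<∞ =
    locally-superconnected indℤ (λ {z} _ → z , refl) ,
    locally-superconnected indℕ₁ (λ {z} 0<z → (z , 0<z) , refl)
    where
    value : ∀ {n} → n <⁺ ∞ → ∃[ k ] n ≡ [ k ]
    value [ k ]<⊤⁺ = k , refl
    open Finite 𝓑 K (λ p → proj₁ (value (κ<∞ p))) (λ p → proj₂ (value (κ<∞ p)))

  connected : ∀ {X} (T : Topology X) → LocallySuperconnected T → LocallyConnected T
  connected T = locally-map Superconnected T superconnected⇒connected

  finite : ∀ {X} {f : X → ℤ} {T : Topology X} → IsInducedBy f (𝒯 𝓑 K) T →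
    (∀ {z} → 0ℤ < z → ∃[ x ] f x ≡ z) → LocallyConnected T → κ<∞ 𝓑 K
  finite ind onto lc p = below (κ p) (locallyConnected⇒≢∞ 𝓑 K ind onto lc p)
    where
    below : ∀ n → n ≢ ∞ → n <⁺ ∞
    below ⊤⁺    n≢∞ = contradiction refl n≢∞
    below [ k ] _   = [ k ]<⊤⁺
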